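{- Let $S$ be a bounded semilattice. Then the graph $G(S)$ is a tree if and only if it is a star graph.
   Context: A bounded semilattice $(S,\cdot,0,1)$ is a commutative semigroup whose operation is idempotent ($x\cdot x=x$ for all $x$), with a neutral element $1$ and an absorbing element $0$; it is partially ordered by $x\le y \iff x\cdot y=x$, so that $0\le x\le 1$. The graph $G(S)$ is the simple graph (possibly infinite) with vertex set $S\setminus\{0,1\}$ in which two vertices $x,y$ are adjacent iff $x\ne y$ and $x\cdot y\neq 0$. A tree is a nonempty undirected graph in which any two vertices are connected by exactly one path. A star graph is a complete bipartite graph one of whose two parts has exactly one element; the other part may be of any size, including empty (so the one-vertex graph counts as a star). -}

module Defs where

open import Level using (_⊔_; suc)
open import Algebra.Definitions using (Zero)
open import Algebra.Lattice.Structures using (IsBoundedSemilattice)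
open import Data.List.Base using (List; []; _∷_)
import Data.List.Relation.Binary.Equality.Setoid as ListEquality
import Data.List.Relation.Unary.Unique.Setoid as ListUnique
open import Data.Product using (Σ; ∃!; ∃-syntax; _×_; _,_; proj₁; proj₂)
open import Data.Sum.Base using (_⊎_)
open import Function.Base using (_on_)
open import Function.Bundles using (_⇔_)
open import Relation.Binary.Bundles using (Setoid)
open import Relation.Binary.Core using (Rel)
open import Relation.Binary.Definitions using (Symmetric; Irreflexive; _Respects_; _Respects₂_)
import Relation.Binary.Construct.On as On
open import Relation.Nullary.Negation.Core using (¬_)
open import Relation.Unary using (Pred)


-- The library's `IsBoundedSemilattice` provides only the neutral element, so
-- the absorbing element is added here. Nothing forces 0# ≉ 1#.

record BoundedSemilattice c ℓ : Set (suc (c ⊔ ℓ)) where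
  infixl 7 _·_
  infix  4 _≈_
  field
    Carrier              : Set c
    _≈_                  : Rel Carrier ℓ
    _·_                  : Carrier → Carrier → Carrier
    0#                   : Carrier
    1#                   : Carrier
    isBoundedSemilattice : IsBoundedSemilattice _≈_ _·_ 1#
    zero                 : Zero _≈_ 0# _·_

  open IsBoundedSemilattice _≈_ isBoundedSemilattice public

  infix 4 _≉_
  _≉_ : Rel Carrier ℓ
  x ≉ y = ¬ (x ≈ y)

record SimpleGraph v ℓ e : Set (suc (v ⊔ ℓ ⊔ e)) where
  infix 4 _~_
  field
    vertexSetoid : Setoid v ℓ

  open Setoid vertexSetoid public
    using (_≈_; _≉_)
    renaming (Carrier to Vertex)

  field
    _~_      : Rel Vertex e
    ~-resp-≈ : _~_ Respects₂ _≈_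
    ~-sym    : Symmetric _~_
    ~-irrefl : Irreflexive _≈_ _~_

module _ {v ℓ e} (G : SimpleGraph v ℓ e) where
  open SimpleGraph G
  open ListEquality vertexSetoid using (_≋_)
  open ListUnique vertexSetoid using (Unique)

  data Walk : Vertex → Vertex → Set (v ⊔ ℓ ⊔ e) where
    [_] : ∀ {x y} → x ≈ y → Walk x y
    _∷_ : ∀ {x y z} → x ~ y → Walk y z → Walk x z

  vertices : ∀ {x y} → Walk x y → List Vertex
  vertices {x} [ _ ]   = x ∷ []
  vertices {x} (_ ∷ w) = x ∷ vertices w

  IsPath : ∀ {x y} → Walk x y → Set (v ⊔ ℓ)
  IsPath w = Unique (vertices w)

  -- In a simple graph a walk is determined by its sequence of vertices, so
  -- walks are compared through that sequence and not through the particular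
  -- proofs of adjacency they contain.

  SameWalk : ∀ {x y} → Rel (Walk x y) (v ⊔ ℓ)
  SameWalk = _≋_ on vertices

  IsTree : Set (v ⊔ ℓ ⊔ e)
  IsTree = Vertex × (∀ x y → ∃! (SameWalk {x} {y}) IsPath)

  record IsCompleteBipartite {p} (A B : Pred Vertex p) : Set (v ⊔ ℓ ⊔ e ⊔ p) where
    field
      A-resp-≈ : A Respects _≈_
      B-resp-≈ : B Respects _≈_
      cover    : ∀ x → A x ⊎ B x
      disjoint : ∀ x → ¬ (A x × B x)
      adjacent : ∀ x y → x ~ y ⇔ ((A x × B y) ⊎ (B x × A y))

  -- B may be empty. The universe level of the parts is immaterial: `cover`
  -- and `disjoint` make membership in them decidable.

  IsStar : Set (v ⊔ suc ℓ ⊔ e)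
  IsStar = ∃[ A ] ∃[ B ] (IsCompleteBipartite {ℓ} A B × ∃! _≈_ A)

module _ {c ℓ} (S : BoundedSemilattice c ℓ) where
  open BoundedSemilattice S

  G : SimpleGraph (c ⊔ ℓ) ℓ ℓ
  G = record
    { vertexSetoid = record
      { Carrier       = Σ Carrier λ x → x ≉ 0# × x ≉ 1#
      ; _≈_           = _≈_ on proj₁
      ; isEquivalence = On.isEquivalence proj₁ isEquivalence
      }
    ; _~_      = λ (x , _) (y , _) → x ≉ y × x · y ≉ 0#
    ; ~-resp-≈ =
        (λ y≈z (x≉y , xy≉0) →
          (λ x≈z → x≉y (trans x≈z (sym y≈z))) ,
          (λ xz≈0 → xy≉0 (trans (∙-cong refl y≈z) xz≈0))) ,
        (λ x≈z (x≉y , xy≉0) →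
          (λ z≈y → x≉y (trans x≈z z≈y)) ,
          (λ zy≈0 → xy≉0 (trans (∙-cong x≈z refl) zy≈0)))
    ; ~-sym    = λ {(x , _)} {(y , _)} (x≉y , xy≉0) →
        (λ y≈x → x≉y (sym y≈x)) ,
        (λ yx≈0 → xy≉0 (trans (comm x y) yx≈0))
    ; ~-irrefl = λ x≈y (x≉y , _) → x≉y x≈y
    }

{-# OPTIONS --safe #-}
-- In a triangle-free G(S), adjacent vertices x, y are comparable, since
-- otherwise x, y and x · y form a triangle; a three-element chain is a triangle
-- as well. Hence if x < y is an edge, all neighbours of y lie below y, and a
-- vertex adjacent to such a neighbour u is y itself, because it has a nonzero
-- product with y and would otherwise form a triangle with u and y. By
-- connectedness, every other vertex is adjacent to y, and y is the centre of a
-- star. Conversely, a path in a star has at most three vertices, and three only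
-- when it joins two leaves through the centre.
module Submission where

open import Level using (Lift; lift; lower; _⊔_)
open import Algebra.Lattice.Bundles using (Semilattice)
import Algebra.Lattice.Properties.Semilattice as SemilatticeProperties
open import Axiom.ExcludedMiddle using (ExcludedMiddle)
open import Data.List.Base using (List; []; _∷_)
import Data.List.Relation.Binary.Equality.Setoid as ListEquality
open import Data.List.Relation.Unary.All using (All; []; _∷_)
open import Data.List.Relation.Unary.AllPairs using ([]; _∷_)
open import Data.Product using (∃-syntax; _×_; _,_; proj₁; proj₂)
open import Data.Sum.Base using (_⊎_; inj₁; inj₂; [_,_]′)
open import Function.Base using (_∘_)
open import Function.Bundles using (_⇔_; mk⇔; Equivalence)
open import Relation.Binary.Bundles using (Setoid)
open import Relation.Binary.Definitions using (Decidable)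
import Relation.Binary.Lattice as OrderTheory
open import Relation.Nullary.Decidable using (yes; no; map′)
open import Relation.Nullary.Negation using (¬_; contradiction)
open import Defs

module _ {v ℓ e} (𝒢 : SimpleGraph v ℓ e) where
  open SimpleGraph 𝒢
  open Setoid vertexSetoid using (refl; sym; trans)
  open ListEquality vertexSetoid using (_≋_; []; _∷_; ≋-sym; ≋-trans)

  TriangleFree : Set (v ⊔ e)
  TriangleFree = ∀ x y z → x ~ y → y ~ z → ¬ x ~ z

  ~⇒≉ : ∀ {x y} → x ~ y → x ≉ y
  ~⇒≉ x~y x≈y = ~-irrefl x≈y x~y

  -- In a triangle, the edge from `x` to `z` and the detour through `y` are two paths between the
  -- same ends, but their vertex lists have different lengths.
  tree⇒triangleFree : IsTree 𝒢 → TriangleFree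
  tree⇒triangleFree (_ , path) x y z x~y y~z x~z
    with path x z
  ... | _ , _ , unique
    with ≋-trans (≋-sym (unique {x~z ∷ [ refl ]} ((~⇒≉ x~z ∷ []) ∷ [] ∷ [])))
                 (unique {x~y ∷ (y~z ∷ [ refl ])}
                   ((~⇒≉ x~y ∷ ~⇒≉ x~z ∷ []) ∷ (~⇒≉ y~z ∷ []) ∷ [] ∷ []))
  ... | _ ∷ _ ∷ ()

  -- The parts are the class of `a` and its complement. An edge inside the complement would close a
  -- triangle with `a`.
  dominating⇒star : TriangleFree → ∀ a → (∀ x → a ≈ x ⊎ a ~ x) → IsStar 𝒢
  dominating⇒star triangleFree a dominating =
    (a ≈_) , (a ≉_) , bipartite , a , refl , λ a≈x → a≈x
    where
    edge : ∀ x y → x ~ y → (a ≈ x × a ≉ y) ⊎ (a ≉ x × a ≈ y)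
    edge x y x~y with dominating x | dominating y
    ... | inj₁ a≈x | _        = inj₁ (a≈x , λ a≈y → ~⇒≉ x~y (trans (sym a≈x) a≈y))
    ... | inj₂ a~x | inj₁ a≈y = inj₂ (~⇒≉ a~x , a≈y)
    ... | inj₂ a~x | inj₂ a~y = contradiction a~y (triangleFree a x y a~x x~y)

    spoke : ∀ {x y} → a ≈ x → a ≉ y → x ~ y
    spoke {y = y} a≈x a≉y with dominating y
    ... | inj₁ a≈y = contradiction a≈y a≉y
    ... | inj₂ a~y = ~-resp-≈ .proj₂ a≈x a~y

    bipartite : IsCompleteBipartite 𝒢 (a ≈_) (a ≉_)
    bipartite = record
      { A-resp-≈ = λ x≈y a≈x → trans a≈x x≈y
      ; B-resp-≈ = λ x≈y a≉x a≈y → a≉x (trans a≈y (sym x≈y))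
      ; cover    = λ x → [ inj₁ , inj₂ ∘ ~⇒≉ ]′ (dominating x)
      ; disjoint = λ _ (a≈x , a≉x) → a≉x a≈x
      ; adjacent = λ x y → mk⇔ (edge x y)
          [ (λ (a≈x , a≉y) → spoke a≈x a≉y)
          , (λ (a≉x , a≈y) → ~-sym (spoke a≈y a≉x))
          ]′
      }

  -- Exposes the head of the vertex list of a walk that has not been matched on, so that long walks
  -- can be refuted without splitting their tail.
  all-vertices⇒source : ∀ {p} {P : Vertex → Set p} {x y} (w : Walk 𝒢 x y) →
                        All P (vertices 𝒢 w) → P x
  all-vertices⇒source [ _ ]   (px ∷ _) = px
  all-vertices⇒source (_ ∷ _) (px ∷ _) = px

  module _ (_≟_ : Decidable _≈_) {p} {A B : Vertex → Set p}
           (bipartite : IsCompleteBipartite 𝒢 A B)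
           {a} (Aa : A a) (a-unique : ∀ {x} → A x → a ≈ x) where
    open IsCompleteBipartite bipartite

    private
      A-≈ : ∀ {x y} → A x → A y → x ≈ y
      A-≈ Ax Ay = trans (sym (a-unique Ax)) (a-unique Ay)

      A-~ : ∀ {x y} → A x → x ~ y → B y
      A-~ {x} {y} Ax x~y with Equivalence.to (adjacent x y) x~y
      ... | inj₁ (_ , By) = By
      ... | inj₂ (Bx , _) = contradiction (Ax , Bx) (disjoint x)

      B-~ : ∀ {x y} → B x → x ~ y → A y
      B-~ {x} {y} Bx x~y with Equivalence.to (adjacent x y) x~y
      ... | inj₁ (Ax , _) = contradiction (Ax , Bx) (disjoint x)
      ... | inj₂ (_ , Ay) = Ay

      A~B : ∀ {x y} → A x → B y → x ~ y
      A~B {x} {y} Ax By = Equivalence.from (adjacent x y) (inj₁ (Ax , By))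

      -- The possible vertex lists of a path in a star. The last entry is a separate `y′`, because a
      -- walk ends at a vertex that is only `≈` to its target.
      data Shape (x y : Vertex) : List Vertex → Set (v ⊔ ℓ ⊔ e ⊔ p) where
        here   : x ≈ y → Shape x y (x ∷ [])
        direct : ∀ {y′} → x ~ y → y′ ≈ y → Shape x y (x ∷ y′ ∷ [])
        via    : ∀ {c y′} → x ≉ y → B x → A c → B y → y′ ≈ y →
                 Shape x y (x ∷ c ∷ y′ ∷ [])

      ~⇒¬leaves : ∀ {x y} → x ~ y → B x → ¬ B y
      ~⇒¬leaves {y = y} x~y Bx By = disjoint y (B-~ Bx x~y , By)

      -- The endpoints determine the shape: `here` needs equal ends, `direct` adjacent ones, and
      -- `via` two distinct leaves, which are never adjacent.
      shape-unique : ∀ {x y us vs} → Shape x y us → Shape x y vs → us ≋ vs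
      shape-unique (here _)               (here _)               = refl ∷ []
      shape-unique (here x≈y)             (direct x~y _)         = contradiction x≈y (~⇒≉ x~y)
      shape-unique (here x≈y)             (via x≉y _ _ _ _)      = contradiction x≈y x≉y
      shape-unique (direct x~y _)         (here x≈y)             = contradiction x≈y (~⇒≉ x~y)
      shape-unique (direct _ u≈y)         (direct _ v≈y)         = refl ∷ trans u≈y (sym v≈y) ∷ []
      shape-unique (direct x~y _)         (via _ Bx _ By _)      = contradiction By (~⇒¬leaves x~y Bx)
      shape-unique (via x≉y _ _ _ _)      (here x≈y)             = contradiction x≈y x≉y
      shape-unique (via _ Bx _ By _)      (direct x~y _)         = contradiction By (~⇒¬leaves x~y Bx)
      shape-unique (via _ _ Ac _ u≈y)     (via _ _ Ad _ v≈y)     =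
        refl ∷ A-≈ Ac Ad ∷ trans u≈y (sym v≈y) ∷ []

      -- A walk alternates between the parts and `A` is a single class, so a path meets `A` at most
      -- once. Two steps from the centre, or three from a leaf, would meet it twice.
      path-shape : ∀ {x y} (w : Walk 𝒢 x y) → IsPath 𝒢 w → Shape x y (vertices 𝒢 w)
      path-shape [ x≈y ] _ = here x≈y
      path-shape (x~u ∷ [ u≈y ]) _ = direct (~-resp-≈ .proj₁ u≈y x~u) u≈y
      path-shape {x} (_∷_ {y = c} x~c (c~u ∷ [ u≈y ])) ((_ ∷ x≉u ∷ []) ∷ _)
        with cover x
      ... | inj₁ Ax = contradiction (A-≈ Ax (B-~ (A-~ Ax x~c) c~u)) x≉u
      ... | inj₂ Bx = via (λ x≈y → x≉u (trans x≈y (sym u≈y))) Bx Ac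
                          (B-resp-≈ u≈y (A-~ Ac c~u)) u≈y
        where
        Ac : A c
        Ac = B-~ Bx x~c
      path-shape {x} (x~s ∷ (s~t ∷ (t~u ∷ w))) ((_ ∷ x≉t ∷ _) ∷ (_ ∷ s≉) ∷ _)
        with cover x
      ... | inj₁ Ax = contradiction (A-≈ Ax (B-~ (A-~ Ax x~s) s~t)) x≉t
      ... | inj₂ Bx = contradiction (A-≈ As (B-~ (A-~ As s~t) t~u))
                                    (all-vertices⇒source w s≉)
        where
        As = B-~ Bx x~s

      path : ∀ x y → ∃[ w ] IsPath 𝒢 {x} {y} w
      -- Equal leaves must be split off first: the detour through `a` would visit their class twice.
      path x y with x ≟ y
      ... | yes x≈y = [ x≈y ] , [] ∷ []
      ... | no x≉y with cover x | cover y
      ... | inj₁ Ax | inj₁ Ay = contradiction (A-≈ Ax Ay) x≉y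
      ... | inj₁ Ax | inj₂ By = A~B Ax By ∷ [ refl ] , (x≉y ∷ []) ∷ [] ∷ []
      ... | inj₂ Bx | inj₁ Ay = ~-sym (A~B Ay Bx) ∷ [ refl ] , (x≉y ∷ []) ∷ [] ∷ []
      ... | inj₂ Bx | inj₂ By =
        x~a ∷ (a~y ∷ [ refl ]) , (~⇒≉ x~a ∷ x≉y ∷ []) ∷ (~⇒≉ a~y ∷ []) ∷ [] ∷ []
        where
        x~a = ~-sym (A~B Aa Bx)
        a~y = A~B Aa By

    centred⇒tree : IsTree 𝒢
    centred⇒tree = a , λ x y →
      let w , w-path = path x y in
      w , w-path , λ {w′} w′-path →
        shape-unique (path-shape w w-path) (path-shape w′ w′-path)

  star⇒tree : Decidable _≈_ → IsStar 𝒢 → IsTree 𝒢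
  star⇒tree _≟_ (_ , _ , bipartite , _ , Aa , a-unique) =
    centred⇒tree _≟_ bipartite Aa a-unique

module _ {c ℓ} (S : BoundedSemilattice c ℓ) where
  open BoundedSemilattice S
  open SimpleGraph (G S) using (Vertex; _~_; ~-sym; ~-resp-≈)

  private
    semilattice : Semilattice c ℓ
    semilattice = record { isSemilattice = isSemilattice }

    open OrderTheory.MeetSemilattice
      (SemilatticeProperties.∧-orderTheoreticMeetSemilattice semilattice)
      using (_≤_; x∧y≤x; x∧y≤y; ∧-greatest; antisym)
      renaming (trans to ≤-trans; refl to ≤-refl; reflexive to ≤-reflexive)

    infix 4 _≈ᵛ_ _≤ᵛ_
    _≈ᵛ_ : Vertex → Vertex → Set ℓ
    x ≈ᵛ y = proj₁ x ≈ proj₁ y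

    _≤ᵛ_ : Vertex → Vertex → Set ℓ
    x ≤ᵛ y = proj₁ x ≤ proj₁ y

  nonzero-up : ∀ {x y} → x ≤ y → x ≉ 0# → y ≉ 0#
  nonzero-up {x} x≤y x≉0 y≈0 =
    x≉0 (trans (≤-trans x≤y (≤-reflexive y≈0)) (zero .proj₂ x))

  nonone-down : ∀ {x y} → x ≤ y → y ≉ 1# → x ≉ 1#
  nonone-down {y = y} x≤y y≉1 x≈1 =
    y≉1 (antisym (sym (identityʳ y)) (≤-trans (≤-reflexive (sym x≈1)) x≤y))

  -- Used to produce edges: a nonzero common lower bound lies below the meet.
  ·-nonzero : ∀ {x y z} → z ≤ x → z ≤ y → z ≉ 0# → x · y ≉ 0#
  ·-nonzero z≤x z≤y = nonzero-up (∧-greatest z≤x z≤y)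

  module _ (_≟_ : Decidable _≈_) (triangleFree : TriangleFree (G S)) where

    adjacent⇒comparable : ∀ x y → x ~ y → x ≤ᵛ y ⊎ y ≤ᵛ x
    adjacent⇒comparable x@(a , _ , a≉1) y@(b , _) x~y@(_ , ab≉0)
      with (a · b) ≟ a | (a · b) ≟ b
    -- The order `x ≤ y` unfolds to `x ≈ x · y`.
    ... | yes ab≈a | _        = inj₁ (sym ab≈a)
    ... | no _     | yes ab≈b = inj₂ (trans (sym ab≈b) (comm a b))
    ... | no ab≉a  | no ab≉b  = contradiction m~y (triangleFree m x y m~x x~y)
      where
      m : Vertex
      m = a · b , ab≉0 , nonone-down (x∧y≤x a b) a≉1

      m~x : m ~ x
      m~x = ab≉a , ·-nonzero ≤-refl (x∧y≤x a b) ab≉0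

      m~y : m ~ y
      m~y = ab≉b , ·-nonzero ≤-refl (x∧y≤y a b) ab≉0

    module _ (x y : Vertex) (x≤y : x ≤ᵛ y) (x~y : x ~ y) where

      neighbour-below : ∀ u → y ~ u → u ≤ᵛ y
      neighbour-below u y~u with adjacent⇒comparable y u y~u
      ... | inj₂ u≤y = u≤y
      ... | inj₁ y≤u = contradiction x~u (triangleFree x y u x~y y~u)
        where
        x≤u : x ≤ᵛ u
        x≤u = ≤-trans x≤y y≤u

        x~u : x ~ u
        -- If `x ≈ u`, the chain from `x` through `y` to `u` collapses and forces `x ≈ y`.
        x~u = (λ x≈u → x~y .proj₁ (antisym x≤y (≤-trans y≤u (≤-reflexive (sym x≈u)))))
            , ·-nonzero ≤-refl x≤u (x .proj₂ .proj₁)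

      dominating-step : ∀ u v → u ~ v → y ≈ᵛ u ⊎ y ~ u → y ≈ᵛ v ⊎ y ~ v
      dominating-step u v u~v (inj₁ y≈u) =
        inj₂ (~-resp-≈ .proj₂ {v} {u} {y} (sym y≈u) u~v)
      dominating-step u@(a , _) v@(b , _) u~v (inj₂ y~u) with proj₁ y ≟ b
      ... | yes y≈v = inj₁ y≈v
      ... | no y≉v  = contradiction y~v (triangleFree y u v y~u u~v)
        where
        y~v : y ~ v
        -- The witness is `a · b`, the product of `u` and `v`: it is below `v`, and below `y`
        -- because `u` is.
        y~v = y≉v , ·-nonzero (≤-trans (x∧y≤x a b) (neighbour-below u y~u))
                              (x∧y≤y a b) (u~v .proj₂)

      dominating-walk : ∀ {u v} → Walk (G S) u v → y ≈ᵛ u ⊎ y ~ u → y ≈ᵛ v ⊎ y ~ v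
      dominating-walk [ u≈v ] (inj₁ y≈u) = inj₁ (trans y≈u u≈v)
      dominating-walk {u} {v} [ u≈v ] (inj₂ y~u) =
        inj₂ (~-resp-≈ .proj₁ {y} {u} {v} u≈v y~u)
      dominating-walk {u} (_∷_ {y = v} u~v w) d =
        dominating-walk w (dominating-step u v u~v d)

  tree⇒star : ExcludedMiddle (c ⊔ ℓ) → IsTree (G S) → IsStar (G S)
  tree⇒star em tree@(root , path) = star
    where
    triangleFree : TriangleFree (G S)
    triangleFree = tree⇒triangleFree (G S) tree

    walk : ∀ x y → Walk (G S) x y
    walk x y = path x y .proj₁

    _≟_ : Decidable _≈_
    -- Equality lives at level `ℓ` and is lifted to the level at which `em` is given.
    x ≟ y = map′ lower lift (em {Lift c (x ≈ y)})

    star-at : ∀ y → (∀ x → y ≈ᵛ x ⊎ y ~ x) → IsStar (G S)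
    star-at = dominating⇒star (G S) triangleFree

    star-at-top : ∀ x y → x ≤ᵛ y → x ~ y → IsStar (G S)
    star-at-top x y x≤y x~y = star-at y λ z →
      dominating-walk _≟_ triangleFree x y x≤y x~y
        (walk y z) (inj₁ refl)

    edgeless⇒≈ : ¬ (∃[ x ] ∃[ y ] x ~ y) → ∀ {x y} → Walk (G S) x y → x ≈ᵛ y
    edgeless⇒≈ _ [ x≈y ] = x≈y
    edgeless⇒≈ edgeless {x} (_∷_ {y = u} x~u _) = contradiction (x , u , x~u) edgeless

    star : IsStar (G S)
    star with em {∃[ x ] ∃[ y ] x ~ y}
    -- Without edges every walk is trivial, so connectedness leaves only the class of `root`: a star
    -- with no leaves.
    ... | no edgeless = star-at root λ x → inj₁ (edgeless⇒≈ edgeless (walk root x))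
    ... | yes (x , y , x~y)
      with adjacent⇒comparable _≟_ triangleFree x y x~y
    ... | inj₁ x≤y = star-at-top x y x≤y x~y
    ... | inj₂ y≤x = star-at-top y x y≤x (~-sym {x} {y} x~y)

theorem2p20 : ∀ {c ℓ} → ExcludedMiddle (c ⊔ ℓ) → (S : BoundedSemilattice c ℓ) → IsTree (G S) ⇔ IsStar (G S)
theorem2p20 {c} em S = mk⇔ (tree⇒star S em) (star⇒tree (G S) λ _ _ → map′ lower lift (em {Lift c _}))
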